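{- Let $n,m\ge1$ be integers. Then $$\sum_{\lambda\subset(n^m)}f_\lambda(n)=m^n,$$ where the sum is over partitions $\lambda$ whose Young diagram is contained in the rectangle $(n^m)$ with $m$ rows of length $n$. Furthermore, there is a bijection between the set $W_{n,m}$ of words of length $n$ in the alphabet $[m]=\{1,\ldots,m\}$ and the set $\bigcup_{\lambda\subset(n^m)}\mathrm{ST}(\lambda,n)$ of strict tableaux with filling $[n]$ whose shape $\lambda$ is contained in $(n^m)$.
   Context: A plane partition $\pi=(\pi_{ij})_{i,j\ge1}$ is a two-dimensional array of nonnegative integers with finitely many nonzero entries such that $\pi_{ij}\ge\pi_{i+1\,j}$ and $\pi_{ij}\ge\pi_{i\,j+1}$ for all $i,j$ ($i$ is the row index, $j$ the column index). Zero entries are ignored; the shape of $\pi$ is the partition whose Young diagram is $\{(i,j):\pi_{ij}>0\}$. A plane partition $\pi$ is a strict tableau with filling $[n]=\{1,\ldots,n\}$ if its (nonzero) entries belong to $[n]$ and each $i\in[n]$ appears in exactly one column of $\pi$ (possibly several times in that column). $\mathrm{ST}(\lambda,n)$ is the set of strict tableaux of shape $\lambda$ with filling $[n]$, and $f_\lambda(n)=|\mathrm{ST}(\lambda,n)|$. -}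

module Defs where

open import Data.Empty using (⊥; ⊥-elim)
open import Data.Fin.Base as Fin using (Fin; toℕ; fromℕ<; combine; remQuot; finToFun; funToFin)
open import Data.Fin.Properties as Fin
  using (toℕ-injective; toℕ<n; toℕ-fromℕ<; fromℕ<-toℕ; remQuot-combine; combine-remQuot;
         finToFun-funToFin; funToFin-finToFin)
open import Data.List.Base using (List; []; _∷_; _++_; map; filter; length; lookup; allFin; cartesianProduct; upTo)
open import Data.List.Membership.Propositional using (_∈_)
open import Data.List.Membership.Propositional.Properties
  using (∈-map⁺; ∈-map⁻; ∈-++⁺ˡ; ∈-++⁺ʳ; ∈-++⁻; ∈-filter⁺; ∈-filter⁻; ∈-lookup; ∈-allFin;
         ∈-cartesianProduct⁺; ∈-upTo⁺)
open import Data.List.Properties using (∷-injectiveʳ)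
open import Data.List.Relation.Unary.All as All using (All; []; _∷_)
open import Data.List.Relation.Unary.AllPairs using ([]; _∷_)
open import Data.List.Relation.Unary.Any as Any using (here; there)
open import Data.List.Relation.Unary.Any.Properties using (lookup-index)
open import Data.List.Relation.Unary.Linked as Linked using (Linked; []; [-]; _∷_)
open import Data.List.Relation.Unary.Unique.Propositional using (Unique)
import Data.List.Relation.Unary.Unique.Propositional.Properties as Unique
open import Data.Nat.Base
open import Data.Nat.Properties
open import Data.Product using (Σ; Σ-syntax; ∃; ∃!; _×_; _,_; proj₁; proj₂; uncurry)
open import Data.Sum.Base using (inj₁; inj₂)
open import Function.Base using (_∘_)
open import Function.Bundles using (_⇔_; mk⇔; Bijection; Equivalence)
open import Level using (0ℓ)
open import Relation.Binary.Bundles using (Setoid)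
open import Relation.Binary.PropositionalEquality
  using (_≡_; _≢_; refl; sym; trans; cong; cong₂; subst; setoid; module ≡-Reasoning)
open import Relation.Nullary using (¬_; Dec; yes; no; recompute)
open import Relation.Nullary.Decidable using (map′; _×-dec_; _→-dec_)

-- The proofs are irrelevant, so equality of partitions is equality of `parts`.
record Partition : Set where
  constructor mkPartition
  field
    parts       : List ℕ
    .positive   : All (0 <_) parts
    .decreasing : Linked _≥_ parts

open Partition public

nth : List ℕ → ℕ → ℕ
nth []       _       = 0
nth (x ∷ _)  zero    = x
nth (_ ∷ xs) (suc i) = nth xs i

part : Partition → ℕ → ℕ
part μ = nth (parts μ)

-- Rows and columns are indexed from 0: the cell (i , j) below is the cell
-- (i+1 , j+1) in the usual indexing by positive integers.
infix 4 _,_∈Diagram_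
_,_∈Diagram_ : ℕ → ℕ → Partition → Set
i , j ∈Diagram μ = j < part μ i

-- μ ⊂ (n^m): the diagram of μ lies in m rows of length n.
infix 4 _⊂⟨_^_⟩
_⊂⟨_^_⟩ : Partition → ℕ → ℕ → Set
μ ⊂⟨ n ^ m ⟩ = ∀ i j → i , j ∈Diagram μ → i < m × j < n

Array : Set
Array = ℕ → ℕ → ℕ

infix 4 _≋_
_≋_ : Array → Array → Set
π ≋ ρ = ∀ i j → π i j ≡ ρ i j

record IsPlanePartition (π : Array) : Set where
  field
    finiteSupport     : Σ[ cells ∈ List (ℕ × ℕ) ] (∀ i j → π i j ≢ 0 → (i , j) ∈ cells)
    decreasingColumns : ∀ i j → π i j ≥ π (suc i) j
    decreasingRows    : ∀ i j → π i j ≥ π i (suc j)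

HasShape : Array → Partition → Set
HasShape π μ = ∀ i j → 0 < π i j ⇔ i , j ∈Diagram μ

record IsStrictTableau (n : ℕ) (π : Array) : Set where
  field
    isPlanePartition : IsPlanePartition π
    entries∈[n]      : ∀ i j → π i j ≢ 0 → π i j ≤ n
    exactlyOneColumn : ∀ a → 1 ≤ a → a ≤ n → ∃! _≡_ λ j → ∃ λ i → π i j ≡ a

-- Sets of arrays are setoids under entrywise equality.
SubsetOfArrays : (Array → Set) → Setoid 0ℓ 0ℓ
SubsetOfArrays P = record
  { Carrier       = Σ Array P
  ; _≈_           = λ s t → proj₁ s ≋ proj₁ t
  ; isEquivalence = record
    { refl  = λ i j → refl
    ; sym   = λ e i j → sym (e i j)
    ; trans = λ e e′ i j → trans (e i j) (e′ i j)
    }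
  }

ST : Partition → ℕ → Setoid 0ℓ 0ℓ
ST μ n = SubsetOfArrays λ π → IsStrictTableau n π × HasShape π μ

-- The union of the sets ST μ n over μ ⊂ (n^m).
⋃ST : (n m : ℕ) → Setoid 0ℓ 0ℓ
⋃ST n m = SubsetOfArrays λ π →
  IsStrictTableau n π × Σ[ μ ∈ Partition ] (μ ⊂⟨ n ^ m ⟩ × HasShape π μ)

private

  all< : ∀ N {P : ℕ → Set} → (∀ i → Dec (P i)) → (∀ i → ¬ i < N → P i) → Dec (∀ i → P i)
  all< N {P} P? out = map′ to (λ f {i} _ → f i) (allUpTo? P? N)
    where
    to : (∀ {i} → i < N → P i) → ∀ i → P i
    to f i with i <? N
    ... | yes i<N = f i<N
    ... | no  i≮N = out i i≮N

  any< : ∀ N {P : ℕ → Set} → (∀ i → Dec (P i)) → (∀ i → P i → i < N) → Dec (∃ P)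
  any< N P? bnd = map′ (λ (i , _ , p) → i , p) (λ (i , p) → i , bnd i p , p) (anyUpTo? P? N)

  nth-decr : ∀ xs → Linked _≥_ xs → ∀ i → nth xs (suc i) ≤ nth xs i
  nth-decr []           _        _       = z≤n
  nth-decr (_ ∷ [])     _        _       = z≤n
  nth-decr (_ ∷ _ ∷ _)  (r ∷ _)  zero    = r
  nth-decr (_ ∷ y ∷ xs) (_ ∷ rs) (suc i) = nth-decr (y ∷ xs) rs i

  nth-≥length : ∀ xs i → ¬ i < length xs → nth xs i ≡ 0
  nth-≥length []       _       _ = refl
  nth-≥length (_ ∷ _)  zero    h = ⊥-elim (h z<s)
  nth-≥length (_ ∷ xs) (suc i) h = nth-≥length xs i (h ∘ s<s)

  nth-pos : ∀ xs → All (0 <_) xs → ∀ i → i < length xs → 0 < nth xs i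
  nth-pos (_ ∷ _)  (p ∷ _)  zero    _         = p
  nth-pos (_ ∷ xs) (_ ∷ ps) (suc i) (s≤s i<l) = nth-pos xs ps i i<l

part-decreasing : ∀ μ i → part μ (suc i) ≤ part μ i
part-decreasing (mkPartition xs _ dec) = nth-decr xs (recompute (Linked.linked? _≥?_ xs) dec)

part-positive : ∀ μ i → i < length (parts μ) → 0 < part μ i
part-positive (mkPartition xs pos _) = nth-pos xs (recompute (All.all? (0 <?_) xs) pos)

part≤part₀ : ∀ μ i → part μ i ≤ part μ 0
part≤part₀ μ zero    = ≤-refl
part≤part₀ μ (suc i) = ≤-trans (part-decreasing μ i) (part≤part₀ μ i)

module _ (r c : ℕ) (π : Array) (out : ∀ i j → ¬ (i < r × j < c) → π i j ≡ 0) where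
  private

    inside : ∀ i j → π i j ≢ 0 → i < r × j < c
    inside i j π≢0 with i <? r ×-dec j <? c
    ... | yes h = h
    ... | no ¬h = ⊥-elim (π≢0 (out i j ¬h))

    all²< : ∀ {P : ℕ → ℕ → Set} → (∀ i j → Dec (P i j)) →
            (∀ i j → ¬ (i < r × j < c) → P i j) → Dec (∀ i j → P i j)
    all²< P? o = all< r (λ i → all< c (P? i) (λ j j≮c → o i j (j≮c ∘ proj₂)))
                        (λ i i≮r j → o i j (i≮r ∘ proj₁))

    _≢0? : ∀ x → Dec (x ≢ 0)
    zero  ≢0? = no λ h → h refl
    suc x ≢0? = yes λ ()

  isPlanePartition? : Dec (IsPlanePartition π)
  isPlanePartition? = map′ to from
      (all²< (λ i j → π (suc i) j ≤? π i j)
             (λ i j h → subst (_≤ π i j) (sym (out (suc i) j λ (p , q) → h (<-trans (n<1+n i) p , q))) z≤n)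
       ×-dec
       all²< (λ i j → π i (suc j) ≤? π i j)
             (λ i j h → subst (_≤ π i j) (sym (out i (suc j) λ (p , q) → h (p , <-trans (n<1+n j) q))) z≤n))
    where
    open IsPlanePartition
    to : _ → IsPlanePartition π
    to (dc , dr) = record
      { finiteSupport     = cartesianProduct (upTo r) (upTo c) , λ i j h →
          let p , q = inside i j h in ∈-cartesianProduct⁺ (∈-upTo⁺ p) (∈-upTo⁺ q)
      ; decreasingColumns = dc
      ; decreasingRows    = dr
      }
    from : IsPlanePartition π → _
    from p = decreasingColumns p , decreasingRows p

  isStrictTableau? : ∀ n → Dec (IsStrictTableau n π)
  isStrictTableau? n = map′ to from
      (isPlanePartition?
       ×-dec all²< (λ i j → (π i j ≢0?) →-dec (π i j ≤? n)) (λ i j h π≢0 → ⊥-elim (π≢0 (out i j h)))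
       ×-dec all< (suc n) oneColumn? (λ a a≮ _ a≤n → ⊥-elim (a≮ (s≤s a≤n))))
    where
    open IsStrictTableau
    Col : ℕ → ℕ → Set
    Col a j = ∃ λ i → π i j ≡ a

    bounds : ∀ {a i j} → 1 ≤ a → π i j ≡ a → i < r × j < c
    bounds {i = i} {j} 1≤a e = inside i j λ e′ → <⇒≢ 1≤a (trans (sym e′) e)

    col? : ∀ a → 1 ≤ a → ∀ j → Dec (Col a j)
    col? a 1≤a j = any< r (λ i → π i j ≟ a) (λ i e → proj₁ (bounds 1≤a e))

    unique? : ∀ a → 1 ≤ a → Dec (∃! _≡_ (Col a))
    unique? a 1≤a = any< c
      (λ j → col? a 1≤a j ×-dec
             map′ (λ f {k} → f k) (λ f k → f {k})
               (all< c (λ k → col? a 1≤a k →-dec (j ≟ k))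
                     (λ k k≮c (i , e) → ⊥-elim (k≮c (proj₂ (bounds 1≤a e))))))
      (λ j ((i , e) , _) → proj₂ (bounds 1≤a e))

    oneColumn? : ∀ a → Dec (1 ≤ a → a ≤ n → ∃! _≡_ (Col a))
    oneColumn? a with 1 ≤? a
    ... | no  1≰a = yes λ 1≤a → ⊥-elim (1≰a 1≤a)
    ... | yes 1≤a = map′ (λ f _ → f) (λ f → f 1≤a) (a ≤? n →-dec unique? a 1≤a)

    to : _ → IsStrictTableau n π
    to (p , q , s) = record { isPlanePartition = p ; entries∈[n] = q ; exactlyOneColumn = s }
    from : IsStrictTableau n π → _
    from t = isPlanePartition t , entries∈[n] t , exactlyOneColumn t

  hasShape? : ∀ μ → (∀ i j → ¬ (i < r × j < c) → ¬ i , j ∈Diagram μ) → Dec (HasShape π μ)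
  hasShape? μ o = all²<
    (λ i j → map′ (uncurry mk⇔) (λ e → Equivalence.to e , Equivalence.from e)
      ((0 <? π i j →-dec j <? part μ i) ×-dec (j <? part μ i →-dec 0 <? π i j)))
    (λ i j h → mk⇔ (λ 0<π → ⊥-elim (<⇒≢ 0<π (sym (out i j h)))) (λ d → ⊥-elim (o i j h d)))

-- f μ n = |ST μ n|, obtained by counting the codes of matrices with entries in
-- {0,…,n}, of the size of the bounding box of μ, that decode to elements of ST μ n.

module Count (μ : Partition) (n : ℕ) where

  rows columns : ℕ
  rows    = length (parts μ)
  columns = part μ 0

  Code : Set
  Code = Fin (suc n ^ (rows * columns))

  decode : Code → Array
  decode k i j with i <? rows | j <? columns
  ... | yes i<r | yes j<c = toℕ (finToFun k (combine (fromℕ< i<r) (fromℕ< j<c)))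
  ... | _       | _       = 0

  private

    decode-out : ∀ k i j → ¬ (i < rows × j < columns) → decode k i j ≡ 0
    decode-out k i j h with i <? rows | j <? columns
    ... | yes i<r | yes j<c = ⊥-elim (h (i<r , j<c))
    ... | yes _   | no  _   = refl
    ... | no  _   | _       = refl

    diagram⊂box : ∀ i j → i , j ∈Diagram μ → i < rows × j < columns
    diagram⊂box i j d = lemma , <-≤-trans d (part≤part₀ μ i)
      where
      lemma : i < rows
      lemma with i <? rows
      ... | yes i<r = i<r
      ... | no  i≮r = ⊥-elim (n≮0 (subst (j <_) (nth-≥length (parts μ) i i≮r) d))

    Good : Array → Set
    Good π = IsStrictTableau n π × HasShape π μ

  good? : ∀ k → Dec (IsStrictTableau n (decode k) × HasShape (decode k) μ)
  good? k = isStrictTableau? rows columns (decode k) (decode-out k) n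
            ×-dec hasShape? rows columns (decode k) (decode-out k) μ (λ i j h d → h (diagram⊂box i j d))

  goodCodes : List Code
  goodCodes = filter good? (allFin _)

  private

    finToFun-injective : ∀ {a b} (k l : Fin (a ^ b)) → (∀ x → finToFun {a} {b} k x ≡ finToFun l x) → k ≡ l
    finToFun-injective {a} {b} k l h = begin
      k                             ≡⟨ funToFin-finToFin {b} {a} k ⟨
      funToFin (finToFun {a} {b} k) ≡⟨ funToFin-cong h ⟩
      funToFin (finToFun {a} {b} l) ≡⟨ funToFin-finToFin {b} {a} l ⟩
      l                             ∎
      where
      open ≡-Reasoning
      funToFin-cong : ∀ {b a} {f g : Fin b → Fin a} → (∀ x → f x ≡ g x) → funToFin f ≡ funToFin g
      funToFin-cong {zero}  _ = refl
      funToFin-cong {suc b} e = cong₂ combine (e Fin.zero) (funToFin-cong (e ∘ Fin.suc))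

    decode-in : ∀ k (x : Fin rows) (y : Fin columns) →
                decode k (toℕ x) (toℕ y) ≡ toℕ (finToFun k (combine x y))
    decode-in k x y with toℕ x <? rows | toℕ y <? columns
    ... | yes p | yes q = cong₂ (λ u v → toℕ (finToFun k (combine u v))) (fromℕ<-toℕ x p) (fromℕ<-toℕ y q)
    ... | yes _ | no  q = ⊥-elim (q (toℕ<n y))
    ... | no  p | _     = ⊥-elim (p (toℕ<n x))

    decode-injective : ∀ {k l} → decode k ≋ decode l → k ≡ l
    decode-injective {k} {l} h = finToFun-injective {suc n} {rows * columns} k l λ z →
      let x , y = remQuot {rows} columns z
          e : toℕ (finToFun k (combine x y)) ≡ toℕ (finToFun l (combine x y))
          e = trans (sym (decode-in k x y)) (trans (h (toℕ x) (toℕ y)) (decode-in l x y))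
      in subst (λ w → finToFun k w ≡ finToFun l w) (combine-remQuot {rows} columns z) (toℕ-injective e)

    module Encode (π : Array) (good : Good π) where
      entry≤n : ∀ i j → π i j ≤ n
      entry≤n i j with π i j ≟ 0
      ... | yes e = subst (_≤ n) (sym e) z≤n
      ... | no  h = IsStrictTableau.entries∈[n] (proj₁ good) i j h

      fun : Fin (rows * columns) → Fin (suc n)
      fun z = let x , y = remQuot {rows} columns z in fromℕ< (s≤s (entry≤n (toℕ x) (toℕ y)))

      encode : Code
      encode = funToFin fun

      π-out : ∀ i j → ¬ (i < rows × j < columns) → π i j ≡ 0
      π-out i j h with π i j in eq
      ... | zero  = refl
      ... | suc _ = ⊥-elim (h (diagram⊂box i j
                      (Equivalence.to (proj₂ good i j) (subst (0 <_) (sym eq) z<s))))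

      fun-combine : ∀ x y → toℕ (fun (combine x y)) ≡ π (toℕ x) (toℕ y)
      fun-combine x y = trans (toℕ-fromℕ< _)
        (cong (λ (u , v) → π (toℕ u) (toℕ v)) (remQuot-combine {rows} {columns} x y))

      decode-encode : decode encode ≋ π
      decode-encode i j with i <? rows | j <? columns
      ... | yes p | yes q = trans (cong toℕ (finToFun-funToFin fun (combine (fromℕ< p) (fromℕ< q))))
                              (trans (fun-combine (fromℕ< p) (fromℕ< q))
                                     (cong₂ π (toℕ-fromℕ< p) (toℕ-fromℕ< q)))
      ... | yes p | no  q = sym (π-out i j (q ∘ proj₂))
      ... | no  p | _     = sym (π-out i j (p ∘ proj₁))

    Good-resp : ∀ {π ρ} → π ≋ ρ → Good π → Good ρ
    Good-resp {π} {ρ} e (t , s) = record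
      { isPlanePartition = record
        { finiteSupport     = proj₁ fs , λ i j h → proj₂ fs i j (h ∘ trans (sym (e i j)))
        ; decreasingColumns = λ i j → subst₂′ (e (suc i) j) (e i j) (decreasingColumns i j)
        ; decreasingRows    = λ i j → subst₂′ (e i (suc j)) (e i j) (decreasingRows i j)
        }
      ; entries∈[n]      = λ i j h → subst (_≤ n) (e i j) (entries∈[n] i j (h ∘ trans (sym (e i j))))
      ; exactlyOneColumn = λ a p q → let j , (i , ij) , u = exactlyOneColumn a p q in
          j , (i , trans (sym (e i j)) ij) , λ {k} (i′ , e′) → u (i′ , trans (e i′ k) e′)
      } , λ i j → mk⇔ (Equivalence.to (s i j) ∘ subst (0 <_) (sym (e i j)))
                      (subst (0 <_) (e i j) ∘ Equivalence.from (s i j))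
      where
      open IsStrictTableau t
      open IsPlanePartition isPlanePartition renaming (finiteSupport to fs)
      subst₂′ : ∀ {x x′ y y′} → x ≡ x′ → y ≡ y′ → x ≤ y → x′ ≤ y′
      subst₂′ refl refl h = h

    lookup-injective : ∀ {A : Set} {xs : List A} → Unique xs → ∀ i j → lookup xs i ≡ lookup xs j → i ≡ j
    lookup-injective (_ ∷ _)  Fin.zero    Fin.zero    _ = refl
    lookup-injective (h ∷ _)  Fin.zero    (Fin.suc j) e = ⊥-elim (All.lookup h (∈-lookup j) e)
    lookup-injective (h ∷ _)  (Fin.suc i) Fin.zero    e = ⊥-elim (All.lookup h (∈-lookup i) (sym e))
    lookup-injective (_ ∷ us) (Fin.suc i) (Fin.suc j) e = cong Fin.suc (lookup-injective us i j e)

  bijection : Bijection (setoid (Fin (length goodCodes))) (ST μ n)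
  bijection = record
    { to        = λ x → decode (lookup goodCodes x) , proj₂ (∈-filter⁻ good? {xs = allFin _} (∈-lookup x))
    ; cong      = λ { refl i j → refl }
    ; bijective = (λ {x} {y} e → lookup-injective (Unique.filter⁺ good? (Unique.allFin⁺ _)) x y
                                   (decode-injective e))
                , λ (π , good) →
                    let open Encode π good
                        k∈ = ∈-filter⁺ good? (∈-allFin encode)
                               (Good-resp (λ i j → sym (decode-encode i j)) good)
                    in Any.index k∈ , λ { refl i j →
                         trans (cong (λ k → decode k i j) (sym (lookup-index k∈))) (decode-encode i j) }
    }

f : Partition → ℕ → ℕ
f μ n = length (Count.goodCodes μ n)

f-isCardinality : ∀ μ n → Bijection (setoid (Fin (f μ n))) (ST μ n)
f-isCardinality = Count.bijection

private

  Bounded : ℕ → Set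
  Bounded n = Σ[ μ ∈ Partition ] part μ 0 ≤ n

  ∅ : Partition
  ∅ = mkPartition [] [] []

  cons : ∀ n → Bounded (suc n) → Bounded (suc n)
  cons n (mkPartition xs pos dec , h) = mkPartition (suc n ∷ xs) (z<s ∷ pos) (linked xs dec h) , ≤-refl
    where
    linked : ∀ xs → Linked _≥_ xs → nth xs 0 ≤ suc n → Linked _≥_ (suc n ∷ xs)
    linked []      _ _ = [-]
    linked (_ ∷ _) l h = h ∷ l

  weaken : ∀ {n} → Bounded n → Bounded (suc n)
  weaken (μ , h) = μ , m≤n⇒m≤1+n h

  -- Split according to whether the largest part is at most n or equal to suc n.
  bounded : (n m : ℕ) → List (Bounded n)
  bounded n       zero    = (∅ , z≤n) ∷ []
  bounded zero    (suc m) = (∅ , z≤n) ∷ []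
  bounded (suc n) (suc m) = map weaken (bounded n (suc m)) ++ map (cons n) (bounded (suc n) m)

-- By partitions⊂-unique and ∈-partitions⊂⇔ below, this lists each μ ⊂ (n^m) exactly once.
partitions⊂ : (n m : ℕ) → List Partition
partitions⊂ n m = map proj₁ (bounded n m)

private

  parts-injective : ∀ {μ ν} → parts μ ≡ parts ν → μ ≡ ν
  parts-injective {mkPartition _ _ _} {mkPartition _ _ _} refl = refl

  Bounded-≡ : ∀ {n} {s t : Bounded n} → proj₁ s ≡ proj₁ t → s ≡ t
  Bounded-≡ {s = μ , h} {_ , h′} refl = cong (μ ,_) (≤-irrelevant h h′)

  cons-injective : ∀ {n} {s t : Bounded (suc n)} → cons n s ≡ cons n t → s ≡ t
  cons-injective e = Bounded-≡ (parts-injective (∷-injectiveʳ (cong (λ u → parts (proj₁ u)) e)))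

  bounded-unique : ∀ n m → Unique (bounded n m)
  bounded-unique n       zero    = [] ∷ []
  bounded-unique zero    (suc m) = [] ∷ []
  bounded-unique (suc n) (suc m) =
    Unique.++⁺ (Unique.map⁺ (λ e → Bounded-≡ (cong proj₁ e)) (bounded-unique n (suc m)))
               (Unique.map⁺ cons-injective (bounded-unique (suc n) m))
               λ (p , q) → disjoint (∈-map⁻ weaken p) (∈-map⁻ (cons n) q)
    where
    disjoint : ∀ {s} → (∃ λ t → t ∈ bounded n (suc m) × s ≡ weaken t) →
               (∃ λ u → u ∈ bounded (suc n) m × s ≡ cons n u) → ⊥
    disjoint ((μ , h) , _ , refl) (u , _ , e) =
      1+n≰n (subst (_≤ n) (cong (λ s → part (proj₁ s) 0) e) h)

  length≤ : ∀ n m {s} → s ∈ bounded n m → length (parts (proj₁ s)) ≤ m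
  length≤ n       zero    (here refl) = z≤n
  length≤ zero    (suc m) (here refl) = z≤n
  length≤ (suc n) (suc m) s∈ with ∈-++⁻ (map weaken (bounded n (suc m))) s∈
  ... | inj₁ p with _ , q , refl ← ∈-map⁻ weaken p     = length≤ n (suc m) q
  ... | inj₂ p with _ , q , refl ← ∈-map⁻ (cons n) p = s≤s (length≤ (suc n) m q)

  bounded-complete : ∀ n m (s : Bounded n) → length (parts (proj₁ s)) ≤ m → s ∈ bounded n m
  bounded-complete n zero (mkPartition [] _ _ , z≤n) _ = here refl
  bounded-complete zero (suc m) (mkPartition [] _ _ , z≤n) _ = here refl
  bounded-complete zero (suc m) (μ@(mkPartition (_ ∷ _) _ _) , h) _ =
    ⊥-elim (n≮0 (<-≤-trans (part-positive μ 0 z<s) h))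
  bounded-complete (suc n) (suc m) (μ , h) l with part μ 0 ≤? n
  ... | yes h′ = ∈-++⁺ˡ (subst (_∈ map weaken (bounded n (suc m))) (Bounded-≡ refl)
                   (∈-map⁺ weaken (bounded-complete n (suc m) (μ , h′) l)))
  bounded-complete (suc n) (suc m) (mkPartition [] _ _ , h) l | no h′ = ⊥-elim (h′ z≤n)
  bounded-complete (suc n) (suc m) (μ@(mkPartition (x ∷ xs) pos dec) , h) (s≤s l) | no h′
    with refl ← ≤-antisym h (≰⇒> h′) =
      ∈-++⁺ʳ (map weaken (bounded n (suc m)))
        (subst (_∈ map (cons n) (bounded (suc n) m)) (Bounded-≡ refl)
          (∈-map⁺ (cons n) (bounded-complete (suc n) m
            (mkPartition xs (All.tail pos) (Linked.tail dec) , part-decreasing μ 0) l)))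

partitions⊂-unique : ∀ n m → Unique (partitions⊂ n m)
partitions⊂-unique n m = Unique.map⁺ Bounded-≡ (bounded-unique n m)

∈-partitions⊂⇔ : ∀ n m μ → μ ∈ partitions⊂ n m ⇔ μ ⊂⟨ n ^ m ⟩
∈-partitions⊂⇔ n m μ = mk⇔ to from
  where
  to : μ ∈ partitions⊂ n m → μ ⊂⟨ n ^ m ⟩
  to p i j d with (_ , h) , q , refl ← ∈-map⁻ proj₁ p =
    <-≤-trans i<l (length≤ n m q) , <-≤-trans d (≤-trans (part≤part₀ μ i) h)
    where
    i<l : i < length (parts μ)
    i<l with i <? length (parts μ)
    ... | yes i<l = i<l
    ... | no  i≮l = ⊥-elim (n≮0 (subst (j <_) (nth-≥length (parts μ) i i≮l) d))

  from : μ ⊂⟨ n ^ m ⟩ → μ ∈ partitions⊂ n m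
  from h = ∈-map⁺ proj₁ (bounded-complete n m (μ , first≤n) len≤m)
    where
    first≤n : part μ 0 ≤ n
    first≤n with part μ 0 ≤? n
    ... | yes p = p
    ... | no  p = ⊥-elim (n≮n n (proj₂ (h 0 n (≰⇒> p))))
    len≤m : length (parts μ) ≤ m
    len≤m with length (parts μ) ≤? m
    ... | yes p = p
    ... | no  p = ⊥-elim (n≮n m (proj₁ (h m 0 (part-positive μ m (≰⇒> p)))))

{-# OPTIONS --safe #-}

-- Removing the entries equal to a from a strict tableau with entries ≥ a removes
-- bottom cells of a single column.  Conversely, given the shape of the entries > a
-- and the lowest row x in which a is to occur, the column is forced: it is the first
-- free one in row x, and a fills all its free cells down to row x.  So a strict
-- tableau with at most m rows is the same as the sequence of the rows x ∈ [m]
-- chosen for a = n, …, 1, that is, a word.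

module Submission where

open import Defs
open import Data.Fin.Base using (Fin; toℕ; fromℕ<)
open import Data.Fin.Properties using (toℕ<n; toℕ-injective; toℕ-fromℕ<)
open import Data.List.Base
  using (List; []; _∷_; _++_; map; length; allFin; upTo; cartesianProduct; cartesianProductWith)
open import Data.List.Membership.Propositional using (_∈_)
open import Data.List.Membership.Propositional.Properties
  using (∈-++⁺ˡ; ∈-++⁺ʳ; ∈-++⁻; ∈-map⁺; ∈-map⁻; ∈-allFin; ∈-upTo⁺;
         ∈-cartesianProduct⁺; ∈-cartesianProductWith⁺)
open import Data.List.Properties using (length-++; length-map; length-tabulate)
open import Data.List.Relation.Binary.BagAndSetEquality using (∼bag⇒↭)
open import Data.List.Membership.Propositional.Properties.WithK using (unique∧set⇒bag)
open import Data.List.Relation.Binary.Permutation.Propositional.Properties using (↭-length)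
open import Data.List.Relation.Unary.All as All using (All; []; _∷_)
open import Data.List.Relation.Unary.AllPairs using ([]; _∷_)
open import Data.List.Relation.Unary.Any using (here; there)
open import Data.List.Relation.Unary.Linked using (Linked; []; [-]; _∷_)
open import Data.List.Relation.Unary.Unique.Propositional using (Unique)
import Data.List.Relation.Unary.Unique.Propositional.Properties as Unique
open import Data.Nat.Base
open import Data.Nat.ListAction using (sum)
open import Data.Nat.Properties
open import Data.Product using (Σ-syntax; ∃; _,_; proj₁; proj₂)
open import Data.Product.Base using (_×_)
open import Data.Sum.Base using (_⊎_; inj₁; inj₂; [_,_]′)
open import Data.Vec.Base using (Vec; []; _∷_)
open import Data.Vec.Properties using (∷-injective)
open import Function.Base using (_∘_)
open import Function.Bundles using (Bijection; Equivalence; _⇔_; mk⇔)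
open import Relation.Binary.PropositionalEquality
  using (_≡_; refl; sym; trans; cong; cong₂; subst; setoid)
open import Relation.Nullary using (¬_; Dec; yes; no; recompute; contradiction)

private
  variable
    m n : ℕ

-- Row lengths of the shape built from a word.

∀<⇒≤ : ∀ {a b} → (∀ j → j < a → j < b) → a ≤ b
∀<⇒≤ {a} {b} h = ≮⇒≥ λ b<a → n≮n b (h b b<a)

∀<⇔⇒≡ : ∀ {a b} → (∀ j → j < a ⇔ j < b) → a ≡ b
∀<⇔⇒≡ h = ≤-antisym (∀<⇒≤ λ j → Equivalence.to (h j)) (∀<⇒≤ λ j → Equivalence.from (h j))

-- The head of a word is the row chosen for the value 1, the last one to be placed;
-- the tail is the word of the values ≥ 2 lowered by 1.
rowLength : Vec (Fin m) n → ℕ → ℕ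
rowLength []       i = 0
rowLength (x ∷ xs) i with i ≤? toℕ x
... | yes _ = rowLength xs i ⊔ suc (rowLength xs (toℕ x))
... | no  _ = rowLength xs i

module _ (x : Fin m) (xs : Vec (Fin m) n) where

  rowLength-old : ∀ {i j} → j < rowLength xs i → j < rowLength (x ∷ xs) i
  rowLength-old {i} h with i ≤? toℕ x
  ... | yes _ = m≤n⇒m≤n⊔o _ h
  ... | no  _ = h

  rowLength-new : ∀ {i j} → i ≤ toℕ x → j ≤ rowLength xs (toℕ x) → j < rowLength (x ∷ xs) i
  rowLength-new {i} i≤x h with i ≤? toℕ x
  ... | yes _   = m≤n⇒m≤o⊔n (rowLength xs i) (s≤s h)
  ... | no  i≰x = contradiction i≤x i≰x

  rowLength-∷⁻ : ∀ {i j} → j < rowLength (x ∷ xs) i →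
                 j < rowLength xs i ⊎ (i ≤ toℕ x × j ≤ rowLength xs (toℕ x))
  rowLength-∷⁻ {i} {j} h with i ≤? toℕ x
  ... | no  _   = inj₁ h
  ... | yes i≤x with ≤-total (rowLength xs i) (suc (rowLength xs (toℕ x)))
  ...   | inj₁ p = inj₂ (i≤x , s≤s⁻¹ (subst (j <_) (m≤n⇒m⊔n≡n p) h))
  ...   | inj₂ p = inj₁ (subst (j <_) (m≥n⇒m⊔n≡m p) h)

-- If `x` covers column `j` of row `k`, then `i ≤ k ≤ x`, so the same column of row `i` is covered
-- as well. Hence rows `i ≤ x` have old length at least `rowLength xs (toℕ x)`, and the `⊔` in
-- `rowLength` adds at most one cell to each of them, always in that column.
rowLength-antitone : ∀ (xs : Vec (Fin m) n) {i k} → i ≤ k → rowLength xs k ≤ rowLength xs i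
rowLength-antitone []       _   = z≤n
rowLength-antitone (x ∷ xs) i≤k = ∀<⇒≤ λ j h →
  [ (λ p → rowLength-old x xs (<-≤-trans p (rowLength-antitone xs i≤k)))
  , (λ (k≤x , p) → rowLength-new x xs (≤-trans i≤k k≤x) p)
  ]′ (rowLength-∷⁻ x xs h)

rowLength≤n : ∀ (xs : Vec (Fin m) n) i → rowLength xs i ≤ n
rowLength≤n []       i = z≤n
rowLength≤n (x ∷ xs) i = ∀<⇒≤ λ j h →
  [ (λ p → m≤n⇒m≤1+n (<-≤-trans p (rowLength≤n xs i)))
  , (λ (_ , p) → s≤s (≤-trans p (rowLength≤n xs (toℕ x))))
  ]′ (rowLength-∷⁻ x xs h)

rowLength-pos⇒<m : ∀ (xs : Vec (Fin m) n) {i j} → j < rowLength xs i → i < m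
rowLength-pos⇒<m (x ∷ xs) h =
  [ rowLength-pos⇒<m xs , (λ (i≤x , _) → ≤-<-trans i≤x (toℕ<n x)) ]′ (rowLength-∷⁻ x xs h)

-- The strict tableau of a word.

-- 1 ⊓ (r ∸ j) is the indicator of j < r.
tableau : Vec (Fin m) n → Array
tableau []       i j = 0
tableau (x ∷ xs) i j = 1 ⊓ (rowLength (x ∷ xs) i ∸ j) + tableau xs i j

-- The letter `x` raises the old entries by 1 and puts 1 into the cells that it adds, where the old
-- entry is 0.
tableau-inside⁺ : ∀ (x : Fin m) (xs : Vec (Fin m) n) {i j} → j < rowLength (x ∷ xs) i →
                  tableau (x ∷ xs) i j ≡ suc (tableau xs i j)
tableau-inside⁺ x xs {i} {j} h = cong (_+ tableau xs i j) (m≤n⇒m⊓n≡m (m<n⇒0<n∸m h))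

tableau-inside : ∀ (xs : Vec (Fin m) n) {i j} → j < rowLength xs i → 0 < tableau xs i j
tableau-inside (x ∷ xs) h = subst (0 <_) (sym (tableau-inside⁺ x xs h)) z<s

tableau-outside : ∀ (xs : Vec (Fin m) n) {i j} → rowLength xs i ≤ j → tableau xs i j ≡ 0
tableau-outside []       _ = refl
tableau-outside (x ∷ xs) h = cong₂ (λ u v → 1 ⊓ u + v) (m≤n⇒m∸n≡0 h)
  (tableau-outside xs (≤-trans (∀<⇒≤ λ _ → rowLength-old x xs) h))

tableau-support : ∀ (xs : Vec (Fin m) n) i j → 0 < tableau xs i j ⇔ j < rowLength xs i
tableau-support xs i j = mk⇔
  (λ h → ≰⇒> λ r≤j → <⇒≢ h (sym (tableau-outside xs r≤j)))
  (tableau-inside xs)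

-- Lowering every entry by 1 undoes the last placement: the added cells, filled with 1, drop to 0.
-- This peels the head off a word in the inductions below.
tableau-pred : ∀ (x : Fin m) (xs : Vec (Fin m) n) i j → pred (tableau (x ∷ xs) i j) ≡ tableau xs i j
tableau-pred x xs i j with j <? rowLength (x ∷ xs) i
... | yes h = cong pred (tableau-inside⁺ x xs h)
... | no  h = trans (cong pred (tableau-outside (x ∷ xs) (≮⇒≥ h)))
                (sym (tableau-outside xs (≤-trans (∀<⇒≤ λ _ → rowLength-old x xs) (≮⇒≥ h))))

≋⇒rowLength-≡ : ∀ (xs ys : Vec (Fin m) n) → tableau xs ≋ tableau ys →
                ∀ i → rowLength xs i ≡ rowLength ys i
≋⇒rowLength-≡ xs ys e i = ∀<⇔⇒≡ λ j → mk⇔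
  (Equivalence.to (tableau-support ys i j) ∘ subst (0 <_) (e i j) ∘ tableau-inside xs)
  (Equivalence.to (tableau-support xs i j) ∘ subst (0 <_) (sym (e i j)) ∘ tableau-inside ys)

tableau≤n : ∀ (xs : Vec (Fin m) n) i j → tableau xs i j ≤ n
tableau≤n []       i j = z≤n
tableau≤n (x ∷ xs) i j = +-mono-≤ (m⊓n≤m 1 (rowLength (x ∷ xs) i ∸ j)) (tableau≤n xs i j)

tableau-antitone-column : ∀ (xs : Vec (Fin m) n) i j → tableau xs (suc i) j ≤ tableau xs i j
tableau-antitone-column []       i j = z≤n
tableau-antitone-column (x ∷ xs) i j = +-mono-≤
  (⊓-monoʳ-≤ 1 (∸-monoˡ-≤ j (rowLength-antitone (x ∷ xs) (n≤1+n i)))) (tableau-antitone-column xs i j)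

tableau-antitone-row : ∀ (xs : Vec (Fin m) n) i j → tableau xs i (suc j) ≤ tableau xs i j
tableau-antitone-row []       i j = z≤n
tableau-antitone-row (x ∷ xs) i j = +-mono-≤
  (⊓-monoʳ-≤ 1 (∸-monoʳ-≤ (rowLength (x ∷ xs) i) (n≤1+n j))) (tableau-antitone-row xs i j)

OccursIn : ℕ → Array → ℕ → Set
OccursIn a π j = ∃ λ i → π i j ≡ a

-- The value 1 fills exactly the cells added by `x`, all in column `rowLength xs (toℕ x)`. A value
-- `a + 2` is the value `a + 1` in the tableau of the tail and inherits its column.
tableau-oneColumn : ∀ (xs : Vec (Fin m) n) a → 1 ≤ a → a ≤ n →
                    ∃ λ j → OccursIn a (tableau xs) j × (∀ {k} → OccursIn a (tableau xs) k → j ≡ k)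
tableau-oneColumn [] (suc _) _ ()
tableau-oneColumn (x ∷ xs) 1 _ _ = c , (toℕ x , occurs) , unique
  where
  c = rowLength xs (toℕ x)
  occurs : tableau (x ∷ xs) (toℕ x) c ≡ 1
  occurs = trans (tableau-inside⁺ x xs (rowLength-new x xs ≤-refl ≤-refl))
                 (cong suc (tableau-outside xs ≤-refl))
  unique : ∀ {k} → OccursIn 1 (tableau (x ∷ xs)) k → c ≡ k
  unique {k} (i , e) = last-step
    (rowLength-∷⁻ x xs (Equivalence.to (tableau-support (x ∷ xs) i k) (subst (0 <_) (sym e) z<s)))
    where
    -- An entry 1 in the old shape would have been 0 before the last placement, but entries there
    -- are positive.
    k≮r : ¬ k < rowLength xs i
    k≮r p = >⇒≢ (tableau-inside xs p) (trans (sym (tableau-pred x xs i k)) (cong pred e))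
    last-step : k < rowLength xs i ⊎ (i ≤ toℕ x × k ≤ c) → c ≡ k
    last-step (inj₁ k<r)         = contradiction k<r k≮r
    -- The column is pinned by `c ≤ rowLength xs i ≤ k ≤ c`.
    last-step (inj₂ (i≤x , k≤c)) = ≤-antisym (≤-trans (rowLength-antitone xs i≤x) (≮⇒≥ k≮r)) k≤c
tableau-oneColumn (x ∷ xs) (suc (suc a)) _ (s≤s a≤n)
  with j , (i , e) , unique ← tableau-oneColumn xs (suc a) z<s a≤n =
    j , (i , trans (tableau-inside⁺ x xs j<) (cong suc e)) ,
    λ {k} (i′ , e′) → unique (i′ , trans (sym (tableau-pred x xs i′ k)) (cong pred e′))
  where
  j< : j < rowLength (x ∷ xs) i
  j< = rowLength-old x xs (Equivalence.to (tableau-support xs i j) (subst (0 <_) (sym e) z<s))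

tableau-isStrict : ∀ (xs : Vec (Fin m) n) → IsStrictTableau n (tableau xs)
tableau-isStrict {m} {n} xs = record
  { isPlanePartition = record
    { finiteSupport     = cartesianProduct (upTo m) (upTo n) , λ i j h →
        let j<r = Equivalence.to (tableau-support xs i j) (n≢0⇒n>0 h) in
        ∈-cartesianProduct⁺ (∈-upTo⁺ (rowLength-pos⇒<m xs j<r))
                            (∈-upTo⁺ (<-≤-trans j<r (rowLength≤n xs i)))
    ; decreasingColumns = tableau-antitone-column xs
    ; decreasingRows    = tableau-antitone-row xs
    }
  ; entries∈[n]      = λ i j _ → tableau≤n xs i j
  ; exactlyOneColumn = tableau-oneColumn xs
  }

-- Lowering the entries recovers the tail. The head is the lowest row that grows: row `x` exceeds
-- its old length under `x ∷ xs`, hence also under `y ∷ xs`, which forces `x ≤ y`; the converse is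
-- symmetric.
tableau-injective : ∀ (xs ys : Vec (Fin m) n) → tableau xs ≋ tableau ys → xs ≡ ys
tableau-injective []       []       _ = refl
tableau-injective {m} {suc n} (x ∷ xs) (y ∷ ys) e
  with refl ← tableau-injective xs ys (λ i j →
                trans (sym (tableau-pred x xs i j)) (trans (cong pred (e i j)) (tableau-pred y ys i j)))
  = cong (_∷ xs) (toℕ-injective (≤-antisym (bound x y e) (bound y x λ i j → sym (e i j))))
  where
  bound : ∀ (x y : Fin m) → tableau (x ∷ xs) ≋ tableau (y ∷ xs) → toℕ x ≤ toℕ y
  bound x y e with rowLength-∷⁻ y xs {toℕ x} (subst (rowLength xs (toℕ x) <_)
                     (≋⇒rowLength-≡ (x ∷ xs) (y ∷ xs) e (toℕ x)) (rowLength-new x xs ≤-refl ≤-refl))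
  ... | inj₁ p         = contradiction p (n≮n _)
  ... | inj₂ (x≤y , _) = x≤y

-- Every strict tableau comes from a word.

antitone⇒≥ : ∀ (h : ℕ → ℕ) → (∀ i → h i ≥ h (suc i)) → ∀ {i k} → i ≤ k → h i ≥ h k
antitone⇒≥ h dec i≤k = go (≤⇒≤′ i≤k)
  where
  go : ∀ {i k} → i ≤′ k → h i ≥ h k
  go ≤′-refl       = ≤-refl
  go (≤′-step i≤k) = ≤-trans (dec _) (go i≤k)

-- Search downwards from the bound, which drops by 1 after each failed test. It serves to find the
-- lowest row containing the value 1.
greatest : ∀ m {P : ℕ → Set} → (∀ i → Dec (P i)) → (∀ i → P i → i < m) → ∃ P →
           ∃ λ x → P x × (∀ i → P i → i ≤ x)
greatest zero    P? bnd (i , p) = contradiction (bnd i p) n≮0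
greatest (suc m) P? bnd ∃P with P? m
... | yes p = m , p , λ i q → s≤s⁻¹ (bnd i q)
... | no ¬p = greatest m P? (λ i q → ≤∧≢⇒< (s≤s⁻¹ (bnd i q)) λ { refl → ¬p q }) ∃P

pred≡suc⇒≡ : ∀ {y a} → pred y ≡ suc a → y ≡ suc (suc a)
pred≡suc⇒≡ {suc y} e = cong suc e

-- The 1s become empty cells, and each larger value, lowered by 1, keeps its column. This makes
-- induction on the number of values possible.
pred-isStrict : ∀ {π} → IsStrictTableau (suc n) π → IsStrictTableau n (λ i j → pred (π i j))
pred-isStrict {n} {π} t = record
  { isPlanePartition = record
    { finiteSupport     = proj₁ finiteSupport , λ i j h → proj₂ finiteSupport i j (h ∘ cong pred)
    ; decreasingColumns = λ i j → pred-mono-≤ (decreasingColumns i j)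
    ; decreasingRows    = λ i j → pred-mono-≤ (decreasingRows i j)
    }
  ; entries∈[n]      = λ i j h → pred-mono-≤ (entries∈[n] i j (h ∘ cong pred))
  ; exactlyOneColumn = λ { (suc a) _ a<n →
      let j , (i , e) , unique = exactlyOneColumn (suc (suc a)) z<s (s≤s a<n)
      in j , (i , cong pred e) , λ (i′ , e′) → unique (i′ , pred≡suc⇒≡ e′) }
  }
  where
  open IsStrictTableau t
  open IsPlanePartition isPlanePartition

-- The tail is read from the lowered tableau, the head is the lowest row containing 1. It remains to
-- check that the shape of the resulting word is the support of `π`.
tableau-surjective : ∀ n π → IsStrictTableau n π → (∀ i j → 0 < π i j → i < m) →
                     Σ[ xs ∈ Vec (Fin m) n ] tableau xs ≋ π
tableau-surjective zero π t _ = [] , zeros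
  where
  zeros : ∀ i j → 0 ≡ π i j
  zeros i j with π i j ≟ 0
  ... | yes e = sym e
  ... | no  h = contradiction (n≤0⇒n≡0 (IsStrictTableau.entries∈[n] t i j h)) h
tableau-surjective {m} (suc n) π t π-rows
  with xs , e ← tableau-surjective n (λ i j → pred (π i j)) (pred-isStrict t)
                  (λ i j h → π-rows i j (<-≤-trans h pred[n]≤n))
     | c , (i₀ , e₀) , unique ← IsStrictTableau.exactlyOneColumn t 1 ≤-refl z<s
  with x , πxc≡1 , maximal ← greatest m (λ i → π i c ≟ 1)
                               (λ i p → π-rows i c (subst (0 <_) (sym p) z<s)) (i₀ , e₀)
  = x̂ ∷ xs , agree
  where
  open IsStrictTableau t
  open IsPlanePartition isPlanePartition

  x<m : x < m
  x<m = π-rows x c (subst (0 <_) (sym πxc≡1) z<s)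

  x̂ : Fin m
  x̂ = fromℕ< x<m

  x̂≡x : toℕ x̂ ≡ x
  x̂≡x = toℕ-fromℕ< x<m

  shape-xs⁺ : ∀ {i j} → 1 < π i j → j < rowLength xs i
  shape-xs⁺ {i} {j} h = Equivalence.to (tableau-support xs i j) (subst (0 <_) (sym (e i j)) (pred-mono-≤ h))

  shape-xs⁻ : ∀ {i j} → j < rowLength xs i → 1 < π i j
  shape-xs⁻ {i} {j} h with π i j | e i j
  ... | 0           | e′ = contradiction e′ (>⇒≢ (tableau-inside xs h))
  ... | 1           | e′ = contradiction e′ (>⇒≢ (tableau-inside xs h))
  ... | suc (suc _) | _  = s≤s z<s

  rowLength-x : rowLength xs x ≡ c
  rowLength-x = ≤-antisym
    (≮⇒≥ λ c<r → >⇒≢ (shape-xs⁻ c<r) πxc≡1)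
    -- Left of column `c`, row `x` has entries at least 1, and none equals 1 because 1 occurs only
    -- in column `c`. So these cells belong to the shape of `xs`.
    (∀<⇒≤ λ j j<c → shape-xs⁺ (≤∧≢⇒<
      (subst (_≤ π x j) πxc≡1 (antitone⇒≥ (π x) (decreasingRows x) (<⇒≤ j<c)))
      (λ 1≡π → >⇒≢ j<c (unique (x , sym 1≡π)))))

  c≡ : rowLength xs (toℕ x̂) ≡ c
  c≡ = trans (cong (rowLength xs) x̂≡x) rowLength-x

  shape⁺ : ∀ {i j} → 0 < π i j → j < rowLength (x̂ ∷ xs) i
  shape⁺ {i} {j} h with m≤n⇒m<n∨m≡n h
  ... | inj₁ 1<π = rowLength-old x̂ xs (shape-xs⁺ 1<π)
  -- An entry 1 lies in column `c`, the first free one of row `x`, and by maximality not below row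
  -- `x`.
  ... | inj₂ 1≡π with refl ← unique (i , sym 1≡π) =
    rowLength-new x̂ xs (subst (i ≤_) (sym x̂≡x) (maximal i (sym 1≡π))) (≤-reflexive (sym c≡))

  shape⁻ : ∀ {i j} → j < rowLength (x̂ ∷ xs) i → 0 < π i j
  shape⁻ {i} {j} h with rowLength-∷⁻ x̂ xs h
  ... | inj₁ p           = <⇒≤ (shape-xs⁻ p)
  -- The cell `(x , c)` has entry 1, and entries grow weakly to the left and upwards.
  ... | inj₂ (i≤x , j≤c) = begin
    1     ≡⟨ πxc≡1 ⟨
    π x c ≤⟨ antitone⇒≥ (π x) (decreasingRows x) (subst (j ≤_) c≡ j≤c) ⟩
    π x j ≤⟨ antitone⇒≥ (λ k → π k j) (λ k → decreasingColumns k j) (subst (i ≤_) x̂≡x i≤x) ⟩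
    π i j ∎
    where open ≤-Reasoning

  agree : tableau (x̂ ∷ xs) ≋ π
  agree i j with π i j in eq
  ... | zero  = tableau-outside (x̂ ∷ xs) (≮⇒≥ λ j<r → >⇒≢ (shape⁻ j<r) eq)
  ... | suc _ = trans (tableau-inside⁺ x̂ xs (shape⁺ (subst (0 <_) (sym eq) z<s)))
                      (cong suc (trans (e i j) (cong pred eq)))

-- Shapes as partitions.

∷-linked : ∀ {x} xs → Linked _≥_ xs → nth xs 0 ≤ x → Linked _≥_ (x ∷ xs)
∷-linked []      _ _ = [-]
∷-linked (_ ∷ _) l h = h ∷ l

-- The parts are the values of `h` up to its first 0, after which monotonicity leaves only zeros.
-- The recursion runs on `m`, since shifting `h` by one row lowers the bound by 1.
toPartition : ∀ m (h : ℕ → ℕ) → (∀ i → h i ≥ h (suc i)) → (∀ i → 0 < h i → i < m) →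
              Σ[ μ ∈ Partition ] (∀ i → part μ i ≡ h i)
toPartition m h dec bnd with h 0 in eq
... | zero = mkPartition [] [] [] , λ i →
  sym (n≤0⇒n≡0 (subst (h i ≤_) eq (antitone⇒≥ h dec z≤n)))
toPartition zero    h dec bnd | suc _ = contradiction (bnd 0 (subst (0 <_) (sym eq) z<s)) n≮0
toPartition (suc m) h dec bnd | suc a
  with mkPartition ps pos lnk , e ← toPartition m (h ∘ suc) (dec ∘ suc) (λ i p → s≤s⁻¹ (bnd (suc i) p))
  = mkPartition (suc a ∷ ps) (z<s ∷ pos)
      (∷-linked ps lnk (subst (nth ps 0 ≤_) eq (≤-trans (≤-reflexive (e 0)) (dec 0))))
  , λ { zero → sym eq ; (suc i) → e i }

-- Positivity rules out trailing zeros, which `nth` could not tell from the default value 0 past the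
-- end of a list.
nth-injective : ∀ {xs ys} → All (0 <_) xs → All (0 <_) ys → (∀ i → nth xs i ≡ nth ys i) → xs ≡ ys
nth-injective []       []       e = refl
nth-injective []       (p ∷ _)  e = contradiction (e 0) (<⇒≢ p)
nth-injective (p ∷ _)  []       e = contradiction (e 0) (>⇒≢ p)
nth-injective (_ ∷ ps) (_ ∷ qs) e = cong₂ _∷_ (e 0) (nth-injective ps qs (e ∘ suc))

part-injective : ∀ {μ ν} → (∀ i → part μ i ≡ part ν i) → μ ≡ ν
part-injective {mkPartition xs p _} {mkPartition ys q _} e
  -- The positivity fields are irrelevant; decidability gives usable proofs back.
  with refl ← nth-injective (recompute (All.all? (0 <?_) xs) p) (recompute (All.all? (0 <?_) ys) q) e = refl

hasShape-unique : ∀ {π ρ μ ν} → π ≋ ρ → HasShape π μ → HasShape ρ ν → μ ≡ ν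
hasShape-unique e s t = part-injective λ i → ∀<⇔⇒≡ λ j → mk⇔
  (Equivalence.to (t i j) ∘ subst (0 <_) (e i j) ∘ Equivalence.from (s i j))
  (Equivalence.to (s i j) ∘ subst (0 <_) (sym (e i j)) ∘ Equivalence.from (t i j))

module _ (xs : Vec (Fin m) n) where
  private
    μ,e : Σ[ μ ∈ Partition ] (∀ i → part μ i ≡ rowLength xs i)
    μ,e = toPartition m (rowLength xs) (λ i → rowLength-antitone xs (n≤1+n i)) (λ i → rowLength-pos⇒<m xs)

  shape : Partition
  shape = proj₁ μ,e

  shape-hasShape : HasShape (tableau xs) shape
  shape-hasShape i j = subst (λ r → 0 < tableau xs i j ⇔ j < r) (sym (proj₂ μ,e i)) (tableau-support xs i j)

  shape⊂ : shape ⊂⟨ n ^ m ⟩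
  shape⊂ i j d = rowLength-pos⇒<m xs d′ , <-≤-trans d′ (rowLength≤n xs i)
    where d′ = subst (j <_) (proj₂ μ,e i) d

-- The bijection between words and tableaux.

readWord : ∀ {π μ} → IsStrictTableau n π → HasShape π μ → μ ⊂⟨ n ^ m ⟩ →
           Σ[ xs ∈ Vec (Fin m) n ] tableau xs ≋ π
readWord {n} {π = π} t s μ⊂ = tableau-surjective n π t λ i j p → proj₁ (μ⊂ i j (Equivalence.to (s i j) p))

words↔tableaux : ∀ n m → Bijection (setoid (Vec (Fin m) n)) (⋃ST n m)
words↔tableaux n m = record
  { to        = λ xs → tableau xs , tableau-isStrict xs , shape xs , shape⊂ xs , shape-hasShape xs
  ; cong      = λ { refl i j → refl }
  ; bijective = (λ {xs} {ys} → tableau-injective xs ys)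
              , λ (π , t , μ , μ⊂ , s) →
                  let xs , e = readWord {μ = μ} t s μ⊂ in xs , λ { refl → e }
  }

-- Counting words by shape.

record Enumeration {A : Set} (P : A → Set) (k : ℕ) : Set where
  field
    list     : List A
    unique   : Unique list
    member   : ∀ x → x ∈ list ⇔ P x
    length≡k : length list ≡ k

open Enumeration

-- Duplicate-free lists with the same members are equal as bags, hence permutations of each other.
enumeration-size : ∀ {A : Set} {P : A → Set} {k l} → Enumeration P k → Enumeration P l → k ≡ l
enumeration-size E F = trans (sym (length≡k E)) (trans
  (↭-length (∼bag⇒↭ (unique∧set⇒bag (unique E) (unique F) λ {x} → mk⇔
    (Equivalence.from (member F x) ∘ Equivalence.to (member E x))
    (Equivalence.from (member E x) ∘ Equivalence.to (member F x)))))
  (length≡k F))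

-- Fibres over distinct points are disjoint, so their lists concatenate without duplicates and the
-- sizes add up.
enumerate-fibres : ∀ {A B : Set} (φ : A → B) (g : B → ℕ) bs → Unique bs →
                   (∀ b → b ∈ bs → Enumeration (λ a → φ a ≡ b) (g b)) →
                   Enumeration (λ a → φ a ∈ bs) (sum (map g bs))
enumerate-fibres φ g [] _ _ = record
  { list = [] ; unique = [] ; member = λ a → mk⇔ (λ ()) (λ ()) ; length≡k = refl }
enumerate-fibres φ g (b ∷ bs) (b∉bs ∷ bs!) fibre = record
  { list     = list E ++ list F
  ; unique   = Unique.++⁺ (unique E) (unique F) λ {a} (p , q) →
      All.lookup b∉bs (Equivalence.to (member F a) q) (sym (Equivalence.to (member E a) p))
  ; member   = λ a → mk⇔
      ([ here ∘ Equivalence.to (member E a) , there ∘ Equivalence.to (member F a) ]′ ∘ ∈-++⁻ (list E))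
      (λ { (here p)  → ∈-++⁺ˡ (Equivalence.from (member E a) p)
         ; (there q) → ∈-++⁺ʳ (list E) (Equivalence.from (member F a) q) })
  ; length≡k = trans (length-++ (list E)) (cong₂ _+_ (length≡k E) (length≡k F))
  }
  where
  E = fibre b (here refl)
  F = enumerate-fibres φ g bs bs! λ c → fibre c ∘ there

length-cartesianProductWith : ∀ {A B C : Set} (g : A → B → C) xs ys →
  length (cartesianProductWith g xs ys) ≡ length xs * length ys
length-cartesianProductWith g []       ys = refl
length-cartesianProductWith g (x ∷ xs) ys = trans (length-++ (map (g x) ys))
  (cong₂ _+_ (length-map (g x) ys) (length-cartesianProductWith g xs ys))

allWords : ∀ m n → List (Vec (Fin m) n)
allWords m zero    = [] ∷ []
allWords m (suc n) = cartesianProductWith _∷_ (allFin m) (allWords m n)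

allWords-unique : ∀ m n → Unique (allWords m n)
allWords-unique m zero    = [] ∷ []
allWords-unique m (suc n) =
  Unique.cartesianProductWith⁺ _∷_ ∷-injective (Unique.allFin⁺ m) (allWords-unique m n)

∈-allWords : (xs : Vec (Fin m) n) → xs ∈ allWords m n
∈-allWords []       = here refl
∈-allWords (x ∷ xs) = ∈-cartesianProductWith⁺ _∷_ (∈-allFin x) (∈-allWords xs)

length-allWords : ∀ m n → length (allWords m n) ≡ m ^ n
length-allWords m zero    = refl
length-allWords m (suc n) = trans (length-cartesianProductWith _∷_ (allFin m) (allWords m n))
  (cong₂ _*_ (length-tabulate {n = m} (λ i → i)) (length-allWords m n))

-- The tableaux listed by the bijection are read as words. A word of shape `μ` is among them because
-- its own tableau is in `ST μ n` and a tableau determines its word.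
enumerate-shape : ∀ {k} n m μ → Bijection (setoid (Fin k)) (ST μ n) → μ ⊂⟨ n ^ m ⟩ →
                  Enumeration {Vec (Fin m) n} (λ xs → shape xs ≡ μ) k
enumerate-shape {k} n m μ card μ⊂ = record
  { list     = map word (allFin k)
  ; unique   = Unique.map⁺ word-injective (Unique.allFin⁺ k)
  ; member   = λ xs → mk⇔ (has-shape xs) (listed xs)
  ; length≡k = trans (length-map word (allFin k)) (length-tabulate {n = k} (λ i → i))
  }
  where
  open Bijection card using (to; injective; surjective)

  read : ∀ k → Σ[ xs ∈ Vec (Fin m) n ] tableau xs ≋ proj₁ (to k)
  read k = readWord {μ = μ} (proj₁ (proj₂ (to k))) (proj₂ (proj₂ (to k))) μ⊂

  word : Fin k → Vec (Fin m) n
  word k = proj₁ (read k)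

  word-injective : ∀ {k l} → word k ≡ word l → k ≡ l
  word-injective {k} {l} e = injective λ i j → trans (sym (proj₂ (read k) i j))
    (trans (cong (λ xs → tableau xs i j) e) (proj₂ (read l) i j))

  has-shape : ∀ xs → xs ∈ map word (allFin k) → shape xs ≡ μ
  has-shape xs p with k , _ , refl ← ∈-map⁻ word p =
    hasShape-unique (proj₂ (read k)) (shape-hasShape (word k)) (proj₂ (proj₂ (to k)))

  listed : ∀ xs → shape xs ≡ μ → xs ∈ map word (allFin k)
  listed xs refl with l , e ← surjective (tableau xs , tableau-isStrict xs , shape-hasShape xs) =
    subst (_∈ map word (allFin k))
      (tableau-injective (word l) xs λ i j → trans (proj₂ (read l) i j) (e refl i j))
      (∈-map⁺ word (∈-allFin l))

-- Double counting of all words: once grouped by the shape of their tableau, once letter by letter.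
sum-f≡m^n : ∀ n m → sum (map (λ μ → f μ n) (partitions⊂ n m)) ≡ m ^ n
sum-f≡m^n n m = enumeration-size
  (enumerate-fibres shape (λ μ → f μ n) (partitions⊂ n m) (partitions⊂-unique n m) λ μ p →
    enumerate-shape n m μ (f-isCardinality μ n) (Equivalence.to (∈-partitions⊂⇔ n m μ) p))
  (record
    { list     = allWords m n
    ; unique   = allWords-unique m n
    -- The predicate `shape xs ∈ partitions⊂ n m` holds for every word, so listing all words
    -- enumerates it.
    ; member   = λ xs → mk⇔ (λ _ → Equivalence.from (∈-partitions⊂⇔ n m (shape xs)) (shape⊂ xs))
                            (λ _ → ∈-allWords xs)
    ; length≡k = length-allWords m n
    })

theorem7p1 : ∀ (n m : ℕ) → n ≥ 1 → m ≥ 1 →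
    sum (map (λ μ → f μ n) (partitions⊂ n m)) ≡ m ^ n
    × Bijection (setoid (Vec (Fin m) n)) (⋃ST n m)
theorem7p1 n m _ _ = sum-f≡m^n n m , words↔tableaux n m
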